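{- The axiomatic system $\mathsf{Ax}_{\mathsf{TLCGA}}$ is sound: every formula derivable in $\mathsf{Ax}_{\mathsf{TLCGA}}$ is valid, i.e. true at every state of every concurrent game model.
   Context: **Models.** Fix a finite set $\mathsf{Agt}$ of agents and a set $\mathsf{AP}$ of atomic propositions; a coalition is any subset of $\mathsf{Agt}$. A game form over an outcome set $O$ is $(\mathsf{Act},\mathsf{act},O,\mathsf{out})$ with $\mathsf{Act}\ne\emptyset$, $\mathsf{act}$ assigning to each agent $a$ a non-empty set $\mathsf{act}_a\subseteq\mathsf{Act}$, and $\mathsf{out}:\prod_{a\in\mathsf{Agt}}\mathsf{act}_a\to O$. A concurrent game model is $\mathcal M=(S,\mathsf{Act},\mathfrak g,V)$ with $S\neq\emptyset$ a set of states, $\mathfrak g$ assigning to each $w\in S$ a game form $(\mathsf{Act},\mathsf{act}_w,S,\mathsf{out}_w)$ over $S$, and $V:\mathsf{AP}\to\mathcal P(S)$. A history is a finite word $w_0\zeta_0w_1\cdots\zeta_{n-1}w_n$ ($n\ge 0$) with $w_i\in S$ and $\zeta_i\in\prod_a\mathsf{act}_{w_i}(a)$. A strategy for $a$ maps each history ending in $w$ to an element of $\mathsf{act}_w(a)$; a strategy profile $\Sigma$ assigns a strategy to each agent. The play induced by $\Sigma$ at $w$ is $w_0\zeta_0w_1\zeta_1\cdots$ with $w_0=w$, $\zeta_n=\Sigma(w_0\zeta_0\cdots w_n)$, $w_{n+1}=\mathsf{out}_{w_n}(\zeta_n)$; its path is $w_0w_1w_2\cdots$. $\mathsf{paths}(w,\Sigma,C)$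 is the set of paths of plays induced at $w$ by strategy profiles $\Sigma'$ that agree with $\Sigma$ on all agents in $C$. **Language $\mathsf{TLCGA}$.** State formulas: $\varphi::=p\mid\top\mid\neg\varphi\mid(\varphi\wedge\varphi)\mid(\varphi\vee\varphi)\mid\langle\![\gamma]\!\rangle$; path formulas: $\theta::=\mathsf X\varphi\mid\varphi\,\mathsf U\,\varphi\mid\mathsf G\varphi$; here $p\in\mathsf{AP}$ and $\gamma$ is a goal assignment, i.e. a map from $\mathcal P(\mathsf{Agt})$ to path formulas; $\bot,\to,\leftrightarrow$ are defined as usual. $\mathsf X\top$ is the trivial goal; the support of $\gamma$ is the set of coalitions $C$ with $\gamma(C)\neq\mathsf X\top$. If $\gamma$ has empty support, $\langle\![\gamma]\!\rangle$ is identified with $\top$. **Semantics.** Booleans as usual. For a path $\pi=w_0w_1\cdots$: $\pi\Vdash\mathsf X\varphi$ iff $\varphi$ is true at $w_1$; $\pi\Vdash\varphi\,\mathsf U\,\psi$ iff for some $i$, $\psi$ is true at $w_i$ and $\varphi$ at all $w_j$, $j<i$; $\pi\Vdash\mathsf G\varphi$ iff $\varphi$ is true at all $w_i$. $\mathcal M,s\Vdash\langle\![\gamma]\!\rangle$ iff there is a strategy profile $\Sigma$ such that for every $C\subseteq\mathsf{Agt}$ and every $\pi\in\mathsf{paths}(s,\Sigma,C)$, $\pi\Vdash\gamma(C)$. **Notation on goal assignments.** $\langle\![C_1\triangleright\theta_1,\dots,C_n\triangleright\theta_n]\!\rangle$ denotes $\langle\![\gamma]\!\rangle$ with $\gamma(C_i)=\theta_i$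 and all other coalitions mapped to $\mathsf X\top$. $\gamma^\top$ is the assignment with empty support. $\gamma[C\triangleright\theta]$ is $\gamma$ modified to map $C$ to $\theta$; $\gamma\setminus C:=\gamma[C\triangleright\mathsf X\top]$; $\gamma|_C$ maps each $C'\subseteq C$ to $\gamma(C')$ and all other coalitions to $\mathsf X\top$; $\gamma|_{UG}$ agrees with $\gamma$ on coalitions whose goal is a $\mathsf U$- or $\mathsf G$-formula and maps all others to $\mathsf X\top$. $\gamma$ is long-term temporal if every coalition in its support gets a $\mathsf U$- or $\mathsf G$-formula; such $\gamma$ is of type $\mathsf U$ if at least one coalition gets a $\mathsf U$-formula, and of type $\mathsf G$ if all coalitions in the support get $\mathsf G$-formulas. **Unfolding.** Let $\gamma$ have support $\mathcal F$. $\Delta\gamma$ has support $\{\bigcup\mathcal F'\mid\emptyset\ne\mathcal F'\subseteq\mathcal F\}$, and for each $C$ in that set $$\Delta\gamma(C):=\mathsf X\Big(\bigwedge\{\varphi\mid \exists C'\in\mathcal F,\ C'\subseteq C,\ \gamma(C')=\mathsf X\varphi\}\wedge\langle\![(\gamma|_C)|_{UG}]\!\rangle\Big).$$ $\Delta\gamma\{\phi\}:=\Delta\gamma[\bigcup\mathcal F\triangleright\mathsf X\phi]$. $\mathsf{Finish}(\gamma)=\{\beta\wedge\langle\![\gamma\setminus C]\!\rangle\mid\gamma(C)=\alpha\,\mathsf U\,\beta\}$, $\mathsf{UHolds}(\gamma)=\{\alpha\mid\gamma(C)=\alpha\,\mathsf U\,\beta\text{ for some }C,\beta\}$, $\mathsf{GHolds}(\gamma)=\{\chi\mid\gamma(C)=\mathsf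 G\chi\text{ for some }C\}$. $\mathsf{unfold}(\gamma):=\bigvee\mathsf{Finish}(\gamma)\vee(\bigwedge\mathsf{UHolds}(\gamma)\wedge\bigwedge\mathsf{GHolds}(\gamma)\wedge\langle\![\Delta\gamma]\!\rangle)$; for long-term temporal $\gamma$, $\mathsf{ind}(\gamma,\phi):=\bigvee\mathsf{Finish}(\gamma)\vee(\bigwedge\mathsf{UHolds}(\gamma)\wedge\bigwedge\mathsf{GHolds}(\gamma)\wedge\langle\![\Delta\gamma\{\phi\}]\!\rangle)$. Redundant empty conjunctions/disjunctions are removed. **The system $\mathsf{Ax}_{\mathsf{TLCGA}}$.** Axioms: all classical propositional tautologies and (Triv) $\langle\![\gamma^\top]\!\rangle$; (Safe) $\neg\langle\![\mathsf{Agt}\triangleright\mathsf X\bot]\!\rangle$; (Merge) $\langle\![C_1\triangleright\theta_1]\!\rangle\wedge\dots\wedge\langle\![C_n\triangleright\theta_n]\!\rangle\to\langle\![C_1\triangleright\theta_1,\dots,C_n\triangleright\theta_n]\!\rangle$ for pairwise disjoint (distinct) $C_1,\dots,C_n$; (GrandCoalition) $\langle\![\gamma]\!\rangle\to(\langle\![\gamma[\mathsf{Agt}\triangleright\mathsf X(\varphi\wedge\psi)]]\!\rangle\vee\langle\![\gamma[\mathsf{Agt}\triangleright\mathsf X(\varphi\wedge\neg\psi)]]\!\rangle)$ where $\gamma(\mathsf{Agt})=\mathsf X\varphi$; (Case) $\langle\![\gamma]\!\rangle\to(\langle\![\gamma[C\triangleright\mathsf X(\varphi\wedge\psi)]]\!\rangle\vee\langle\![\gamma|_C[\mathsf{Agt}\triangleright\mathsf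 X\neg\psi]]\!\rangle)$ where $\gamma(C)=\mathsf X\varphi$; (Con) $\langle\![\gamma]\!\rangle\to\langle\![\gamma[C\triangleright\mathsf X(\varphi\wedge\psi)]]\!\rangle$ where $\gamma(C)=\mathsf X\varphi$ and $\gamma(C')=\mathsf X\psi$ for some $C'\subseteq C$; (Fix) $\mathsf{unfold}(\gamma)\leftrightarrow\langle\![\gamma]\!\rangle$ for every goal assignment $\gamma$. Rules: Modus Ponens; (G-Mon) from $\phi\to\psi$ infer $\langle\![\gamma[C\triangleright\mathsf X\phi]]\!\rangle\to\langle\![\gamma[C\triangleright\mathsf X\psi]]\!\rangle$; (R-Ind) from $\mathsf{ind}(\gamma,\phi)\to\phi$ infer $\langle\![\gamma]\!\rangle\to\phi$, for $\gamma$ of type $\mathsf U$; (R-CoInd) from $\phi\to\mathsf{ind}(\gamma,\phi)$ infer $\phi\to\langle\![\gamma]\!\rangle$, for $\gamma$ of type $\mathsf G$. -}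

module Defs where

open import Data.Bool.Base using (Bool; true; false; not; _∧_; _∨_; if_then_else_)
import Data.Bool.Properties as Bool
open import Data.Fin.Base using (Fin; zero; suc)
open import Data.Fin.Properties using (∀-cons)
open import Data.Fin.Subset using (Subset; inside; outside; ⊤; _∈_; _⊆_; _∩_; ⋃; Empty)
open import Data.Fin.Subset.Properties using (_⊆?_; anySubset?)
open import Data.List.Base using (List; []; _∷_; [_]; _++_; map; mapMaybe; filter; foldr)
open import Data.List.NonEmpty.Base as List⁺ using (List⁺; foldr₁; toList)
import Data.List.Membership.DecPropositional as DecMembership
open import Data.List.Relation.Unary.AllPairs.Core using (AllPairs)
open import Data.Maybe.Base using (Maybe; just; nothing)
open import Data.Nat.Base using (ℕ; zero; suc; _<_)
open import Data.Product.Base using (Σ; ∃; ∃₂; _×_; _,_; proj₁; proj₂)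
open import Data.Refinement.Base using (Refinement; Refinement-syntax; value; proof; _,_)
open import Data.Irrelevant as Irrelevant using (Irrelevant)
open import Data.Sum.Base using (_⊎_)
open import Data.Unit.Base renaming (⊤ to Unit) using ()
open import Data.Vec.Base as Vec using (Vec; lookup; tabulate)
open import Data.Vec.Properties using (≡-dec; lookup∘tabulate)
open import Function.Base using (_∘_)
open import Level using (0ℓ)
open import Relation.Binary.Definitions using (DecidableEquality)
open import Relation.Binary.PropositionalEquality.Core using (_≡_; _≢_; sym; subst)
open import Relation.Nullary.Decidable.Core using (Dec; yes; no; ⌊_⌋)
open import Relation.Nullary.Negation.Core using (¬_)
open import Relation.Unary using (Pred; Satisfiable)

-- The finite set of agents is Fin n, so the set of all agents is the full
-- subset ⊤ of Data.Fin.Subset.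

Coalition : ℕ → Set
Coalition n = Subset n

_≟ᶜ_ : ∀ {n} → DecidableEquality (Coalition n)
_≟ᶜ_ = ≡-dec Bool._≟_

allCoalitions : ∀ n → List (Coalition n)
allCoalitions zero    = [ Vec.[] ]
allCoalitions (suc n) = map (inside Vec.∷_) (allCoalitions n)
                     ++ map (outside Vec.∷_) (allCoalitions n)

nonEmptySublists : ∀ {A : Set} → List A → List (List A)
nonEmptySublists []       = []
nonEmptySublists (x ∷ xs) =
  [ x ] ∷ map (x ∷_) (nonEmptySublists xs) ++ nonEmptySublists xs

collect : ∀ {n} {P : Pred (Fin n) 0ℓ} → (∀ a → Irrelevant (P a)) → Irrelevant (∀ a → P a)
collect {zero}  f = Irrelevant.[ (λ ()) ]
collect {suc n} f with f zero | collect (f ∘ suc)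
... | Irrelevant.[ p ] | Irrelevant.[ q ] = Irrelevant.[ ∀-cons p q ]

record GameForm (n : ℕ) (Act O : Set) : Set₁ where
  field
    Act-inhabit : Act
    act         : Fin n → Pred Act 0ℓ
    act-inhabit : ∀ a → Satisfiable (act a)

  -- The product of the sets act a. Tuples are vectors and membership is
  -- irrelevant, so that equal tuples of actions are equal profiles.
  ActionProfile : Set
  ActionProfile = [ ζ ∈ Vec Act n ∣ (∀ a → act a (lookup ζ a)) ]

  field
    out : ActionProfile → O

record ConcurrentGameModel (n : ℕ) (AP : Set) : Set₁ where
  field
    S         : Set
    Act       : Set
    S-inhabit : S
    𝔤         : S → GameForm n Act S
    V         : AP → Pred S 0ℓ

module Plays {n : ℕ} {AP : Set} (M : ConcurrentGameModel n AP) where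
  open ConcurrentGameModel M
  module 𝔤 (w : S) = GameForm (𝔤 w)

  -- Histories, indexed by their last state.
  data History : S → Set where
    start : ∀ w → History w
    _▸_▸_ : ∀ {w} → History w → 𝔤.ActionProfile w → ∀ w′ → History w′

  Strategy : Fin n → Set
  Strategy a = ∀ {w} → History w → [ x ∈ Act ∣ 𝔤.act w a x ]

  StrategyProfile : Set
  StrategyProfile = ∀ a → Strategy a

  move : StrategyProfile → ∀ {w} → History w → 𝔤.ActionProfile w
  move σ {w} h = tabulate choice ,
    collect λ a → Irrelevant.map (subst (𝔤.act w a) (sym (lookup∘tabulate choice a)))
                                 (proof (σ a h))
    where
    choice : Fin n → Act
    choice a = value (σ a h)

  play : StrategyProfile → S → ℕ → ∃ History
  play σ w zero    = w , start w
  play σ w (suc i) =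
    let v , h = play σ w i
        v′    = 𝔤.out v (move σ h)
    in  v′ , (h ▸ move σ h ▸ v′)

  path : StrategyProfile → S → ℕ → S
  path σ w i = proj₁ (play σ w i)

  AgreeOn : Coalition n → StrategyProfile → StrategyProfile → Set
  AgreeOn C σ σ′ = ∀ a → a ∈ C → ∀ {w} (h : History w) → σ′ a h ≡ σ a h

  paths : S → StrategyProfile → Coalition n → Pred (ℕ → S) 0ℓ
  paths w σ C π = Σ StrategyProfile λ σ′ → AgreeOn C σ σ′ × (∀ i → π i ≡ path σ′ w i)

infix  30 `¬_ X_ G_
infix  28 _U_
infixr 25 _`∧_
infixr 24 _`∨_

-- Since a goal assignment with empty support is identified with `⊤, the
-- constructor `goals requires a non-empty support; ⟨[_]⟩ below is total.

data StateFormula (n : ℕ) (AP : Set) : Set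
data PathFormula  (n : ℕ) (AP : Set) : Set
isTrivial : ∀ {n AP} → PathFormula n AP → Bool

data StateFormula n AP where
  var       : AP → StateFormula n AP
  `⊤        : StateFormula n AP
  `¬_       : StateFormula n AP → StateFormula n AP
  _`∧_ _`∨_ : StateFormula n AP → StateFormula n AP → StateFormula n AP
  `goals    : (γ : Coalition n → PathFormula n AP) →
              .(∃ λ C → isTrivial (γ C) ≡ false) → StateFormula n AP

data PathFormula n AP where
  X_  : StateFormula n AP → PathFormula n AP
  _U_ : StateFormula n AP → StateFormula n AP → PathFormula n AP
  G_  : StateFormula n AP → PathFormula n AP

isTrivial (X `⊤) = true
isTrivial _      = false

GoalAssignment : ℕ → Set → Set
GoalAssignment n AP = Coalition n → PathFormula n AP

module _ {n : ℕ} {AP : Set} where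

  infixr 23 _`→_
  infix  22 _`↔_

  `⊥ : StateFormula n AP
  `⊥ = `¬ `⊤

  _`→_ _`↔_ : StateFormula n AP → StateFormula n AP → StateFormula n AP
  φ `→ ψ = `¬ φ `∨ ψ
  φ `↔ ψ = (φ `→ ψ) `∧ (ψ `→ φ)

  _∈supp_ : Coalition n → GoalAssignment n AP → Set
  C ∈supp γ = isTrivial (γ C) ≡ false

  _∈supp?_ : ∀ C γ → Dec (C ∈supp γ)
  C ∈supp? γ = isTrivial (γ C) Bool.≟ false

  ⟨[_]⟩ : GoalAssignment n AP → StateFormula n AP
  ⟨[ γ ]⟩ with anySubset? (_∈supp? γ)
  ... | yes ne = `goals γ ne
  ... | no  _  = `⊤

module Semantics {n : ℕ} {AP : Set} (M : ConcurrentGameModel n AP) where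
  open ConcurrentGameModel M
  open Plays M

  infix 4 _⊩_ _⊩ᵖ_

  _⊩_  : S → StateFormula n AP → Set
  _⊩ᵖ_ : (ℕ → S) → PathFormula n AP → Set

  s ⊩ var p      = V p s
  s ⊩ `⊤         = Unit
  s ⊩ `¬ φ       = ¬ (s ⊩ φ)
  s ⊩ φ `∧ ψ     = (s ⊩ φ) × (s ⊩ ψ)
  s ⊩ φ `∨ ψ     = (s ⊩ φ) ⊎ (s ⊩ ψ)
  s ⊩ `goals γ _ = Σ StrategyProfile λ σ → ∀ C π → paths s σ C π → π ⊩ᵖ γ C

  π ⊩ᵖ X φ     = π 1 ⊩ φ
  π ⊩ᵖ (φ U ψ) = ∃ λ i → (π i ⊩ ψ) × (∀ j → j < i → π j ⊩ φ)
  π ⊩ᵖ G φ     = ∀ i → π i ⊩ φ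

Valid : ∀ {n AP} → StateFormula n AP → Set₁
Valid {n} {AP} φ = (M : ConcurrentGameModel n AP) →
                   let open Semantics M in ∀ s → s ⊩ φ

module _ {n : ℕ} {AP : Set} where

  private
    Form Path Goals : Set
    Form  = StateFormula n AP
    Path  = PathFormula n AP
    Goals = GoalAssignment n AP

  infixl 35 _[_▷_] _∖_ _∣_

  γ⊤ : Goals
  γ⊤ _ = X `⊤

  _[_▷_] : Goals → Coalition n → Path → Goals
  (γ [ C ▷ θ ]) D = if ⌊ D ≟ᶜ C ⌋ then θ else γ D

  _∖_ : Goals → Coalition n → Goals
  γ ∖ C = γ [ C ▷ X `⊤ ]

  _∣_ : Goals → Coalition n → Goals
  (γ ∣ C) D = if ⌊ D ⊆? C ⌋ then γ D else X `⊤

  _∣UG : Goals → Goals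
  (γ ∣UG) C with γ C
  ... | X _   = X `⊤
  ... | α U β = α U β
  ... | G χ   = G χ

  IsU IsG : Path → Set
  IsU θ = ∃₂ λ α β → θ ≡ α U β
  IsG θ = ∃ λ χ → θ ≡ G χ

  LongTermTemporal TypeU TypeG : Goals → Set
  LongTermTemporal γ = ∀ C → C ∈supp γ → IsU (γ C) ⊎ IsG (γ C)
  TypeU γ = LongTermTemporal γ × ∃ λ C → IsU (γ C)
  TypeG γ = LongTermTemporal γ × (∀ C → C ∈supp γ → IsG (γ C))

  support : Goals → List (Coalition n)
  support γ = filter (_∈supp? γ) (allCoalitions n)

  unions : List (Coalition n) → List (Coalition n)
  unions F = map ⋃ (nonEmptySublists F)

  open DecMembership (_≟ᶜ_ {n}) using (_∈?_)

  -- Finite conjunctions (disjunctions) that occur next to a further formula ψ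
  -- are written foldr _`∧_ ψ Φ (foldr _`∨_ ψ Φ), which is ψ if Φ is empty.

  nextGoals : Goals → Coalition n → List Form
  nextGoals γ C = mapMaybe (next ∘ γ) (filter (_⊆? C) (support γ))
    where
    next : Path → Maybe Form
    next (X φ) = just φ
    next _     = nothing

  Δ : Goals → Goals
  Δ γ C = if ⌊ C ∈? unions (support γ) ⌋
          then X (foldr _`∧_ ⟨[ (γ ∣ C) ∣UG ]⟩ (nextGoals γ C))
          else X `⊤

  Δ_⟪_⟫ : Goals → Form → Goals
  Δ γ ⟪ φ ⟫ = Δ γ [ ⋃ (support γ) ▷ X φ ]

  Finish UHolds GHolds : Goals → List Form
  Finish γ = mapMaybe finish (allCoalitions n)
    where
    finish : Coalition n → Maybe Form
    finish C with γ C
    ... | α U β = just (β `∧ ⟨[ γ ∖ C ]⟩)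
    ... | _     = nothing
  UHolds γ = mapMaybe (holds ∘ γ) (allCoalitions n)
    where
    holds : Path → Maybe Form
    holds (α U β) = just α
    holds _       = nothing
  GHolds γ = mapMaybe (holds ∘ γ) (allCoalitions n)
    where
    holds : Path → Maybe Form
    holds (G χ) = just χ
    holds _     = nothing

  unfold : Goals → Form
  unfold γ = foldr _`∨_ (foldr _`∧_ ⟨[ Δ γ ]⟩ (UHolds γ ++ GHolds γ)) (Finish γ)

  ind : Goals → Form → Form
  ind γ φ = foldr _`∨_ (foldr _`∧_ ⟨[ Δ γ ⟪ φ ⟫ ]⟩ (UHolds γ ++ GHolds γ)) (Finish γ)

  -- Truth-table evaluation in which propositional variables and goal formulas
  -- are atoms; v is only consulted on these.
  eval : (Form → Bool) → Form → Bool
  eval v (var p)         = v (var p)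
  eval v `⊤              = true
  eval v (`¬ φ)          = not (eval v φ)
  eval v (φ `∧ ψ)        = eval v φ ∧ eval v ψ
  eval v (φ `∨ ψ)        = eval v φ ∨ eval v ψ
  eval v φ@(`goals _ _)  = v φ

  Tautology : Form → Set
  Tautology φ = ∀ v → eval v φ ≡ true

  DisjointDistinct : Coalition n × Path → Coalition n × Path → Set
  DisjointDistinct (C , _) (D , _) = C ≢ D × Empty (C ∩ D)

  infix 4 ⊢_

  data ⊢_ : Form → Set where
    Taut  : ∀ {φ} → Tautology φ → ⊢ φ
    Triv  : ⊢ ⟨[ γ⊤ ]⟩
    Safe  : ⊢ `¬ ⟨[ γ⊤ [ ⊤ ▷ X `⊥ ] ]⟩
    Merge : (gs : List⁺ (Coalition n × Path)) →
            AllPairs DisjointDistinct (toList gs) →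
            ⊢ foldr₁ _`∧_ (List⁺.map (λ (C , θ) → ⟨[ γ⊤ [ C ▷ θ ] ]⟩) gs)
              `→ ⟨[ foldr (λ (C , θ) γ → γ [ C ▷ θ ]) γ⊤ (toList gs) ]⟩
    GrandCoalition :
            ∀ γ φ ψ → γ ⊤ ≡ X φ →
            ⊢ ⟨[ γ ]⟩ `→ (⟨[ γ [ ⊤ ▷ X (φ `∧ ψ) ] ]⟩ `∨ ⟨[ γ [ ⊤ ▷ X (φ `∧ `¬ ψ) ] ]⟩)
    Case  : ∀ γ C φ ψ → γ C ≡ X φ →
            ⊢ ⟨[ γ ]⟩ `→ (⟨[ γ [ C ▷ X (φ `∧ ψ) ] ]⟩ `∨ ⟨[ (γ ∣ C) [ ⊤ ▷ X (`¬ ψ) ] ]⟩)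
    Con   : ∀ γ C C′ φ ψ → γ C ≡ X φ → γ C′ ≡ X ψ → C′ ⊆ C →
            ⊢ ⟨[ γ ]⟩ `→ ⟨[ γ [ C ▷ X (φ `∧ ψ) ] ]⟩
    Fix   : ∀ γ → ⊢ unfold γ `↔ ⟨[ γ ]⟩

    MP      : ∀ {φ ψ} → ⊢ φ `→ ψ → ⊢ φ → ⊢ ψ
    G-Mon   : ∀ γ C {φ ψ} → ⊢ φ `→ ψ → ⊢ ⟨[ γ [ C ▷ X φ ] ]⟩ `→ ⟨[ γ [ C ▷ X ψ ] ]⟩
    R-Ind   : ∀ γ {φ} → TypeU γ → ⊢ ind γ φ `→ φ → ⊢ ⟨[ γ ]⟩ `→ φ
    R-CoInd : ∀ γ {φ} → TypeG γ → ⊢ φ `→ ind γ φ → ⊢ φ `→ ⟨[ γ ]⟩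

-- The difficult cases are Fix, R-CoInd and R-Ind, which all build strategy
-- profiles along plays. Let σ achieve Δ γ (or its variant with φ) at s. After an
-- action profile ζ at s, only the coalitions inside the set of agents who
-- followed σ are still owed their goals. The union of those in the support of γ
-- is one of the coalitions of Δ γ, so the successor state satisfies what Δ γ
-- promises to that union, and a profile witnessing this promise is played from
-- there on. For R-CoInd one moves on to the profile of the next φ-state as long
-- as this union is the whole support. For R-Ind, suppose that σ achieves γ at a
-- state where φ fails. By hypothesis no until-goal is fulfilled there, and some
-- deviation of agents outside ⋃ (support γ) leads to another such state.
-- Iterating gives a play on which an until-goal of γ is never fulfilled, although
-- the coalition owning it follows σ.

module Submission where

open import Defs
open import Axiom.ExcludedMiddle using (ExcludedMiddle)
open import Data.Bool.Base using (Bool; true; false)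
import Data.Bool.Properties as Bool
open import Data.Empty using (⊥-elim)
open import Data.Fin.Subset using (inside; outside; ⊤; _∈_; _⊆_; _∩_; ⋃; Empty)
open import Data.Fin.Subset.Properties
  using (_⊆?_; _∈?_; anySubset?; p⊆p∪q; q⊆p∪q; x∈p∪q⁻; x∈p∩q⁺; ∉⊥; ∈⊤)
import Data.Irrelevant as Irrelevant
open import Data.List.Base using (List; []; _∷_; _++_; mapMaybe; filter; foldr)
open import Data.List.Membership.Propositional using () renaming (_∈_ to _∈ˡ_)
open import Data.List.Membership.Propositional.Properties
  using (∈-map⁺; ∈-++⁺ˡ; ∈-++⁺ʳ; ∈-filter⁺; ∈-filter⁻)
import Data.List.Membership.DecPropositional as DecMembership
open import Data.List.NonEmpty.Base as List⁺ using (_∷_; foldr₁)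
open import Data.List.Relation.Unary.All as All using (All; []; _∷_)
import Data.List.Relation.Unary.All.Properties as All
open import Data.List.Relation.Unary.AllPairs.Core using (AllPairs; []; _∷_)
open import Data.List.Relation.Unary.Any using (Any; here; there)
open import Data.Maybe.Base using (Maybe; just; nothing)
import Data.Maybe.Relation.Unary.All as MAll
import Data.Maybe.Relation.Unary.Any as MAny
open import Data.Nat.Base using (ℕ; zero; suc; s≤s; s<s; z<s)
open import Data.Product.Base using (Σ; ∃; ∃₂; _×_; _,_; proj₁; proj₂)
open import Data.Refinement.Base using (Refinement; value; proof; _,_)
open import Data.Refinement.Properties using (value-injective)
open import Data.Sum.Base using (_⊎_; inj₁; inj₂; [_,_]′)
open import Data.Unit.Base using (tt) renaming (⊤ to Unit)
open import Data.Vec.Base as Vec using (lookup; tabulate)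
open import Data.Vec.Properties
  using (tabulate-cong; tabulate∘lookup; lookup⇒[]=; []=⇒lookup; lookup∘tabulate)
open import Function.Base using (_∘_; id; case_of_)
open import Level using (0ℓ)
open import Relation.Binary.PropositionalEquality.Core
  using (_≡_; _≢_; refl; sym; trans; cong; subst)
open import Relation.Nullary.Decidable.Core using (yes; no; ⌊_⌋; decidable-stable)
open import Relation.Nullary.Negation.Core using (¬_; contradiction)
open import Relation.Unary using (Pred; Decidable)

-- Lists, sublists and unions of coalitions.

module _ {A B : Set} {f : A → Maybe B} {P : Pred B 0ℓ} where

  All-mapMaybe⁺ : ∀ xs → (∀ x → MAll.All P (f x)) → All P (mapMaybe f xs)
  All-mapMaybe⁺ xs h = All.mapMaybe⁺ (All.map⁺ (All.universal h xs))

  All-mapMaybe⁻ : ∀ {x} xs → All P (mapMaybe f xs) → x ∈ˡ xs → MAll.All P (f x)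
  All-mapMaybe⁻ (x ∷ xs) ps m with f x in eq
  All-mapMaybe⁻ (x ∷ xs) ps       (here refl) | nothing rewrite eq = MAll.nothing
  All-mapMaybe⁻ (x ∷ xs) ps       (there m)   | nothing = All-mapMaybe⁻ xs ps m
  All-mapMaybe⁻ (x ∷ xs) (p ∷ ps) (here refl) | just _ rewrite eq = MAll.just p
  All-mapMaybe⁻ (x ∷ xs) (p ∷ ps) (there m)   | just _ = All-mapMaybe⁻ xs ps m

  Any-mapMaybe⁺ : ∀ {x} xs → x ∈ˡ xs → MAny.Any P (f x) → Any P (mapMaybe f xs)
  Any-mapMaybe⁺ (x ∷ xs) m p with f x in eq
  Any-mapMaybe⁺ (x ∷ xs) (here refl) p | nothing rewrite eq = case p of λ ()
  Any-mapMaybe⁺ (x ∷ xs) (there m)   p | nothing = Any-mapMaybe⁺ xs m p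
  Any-mapMaybe⁺ (x ∷ xs) (here refl) p | just _ rewrite eq = here (MAny.drop-just p)
  Any-mapMaybe⁺ (x ∷ xs) (there m)   p | just _ = there (Any-mapMaybe⁺ xs m p)

  Any-mapMaybe⁻ : ∀ xs → Any P (mapMaybe f xs) → ∃ λ x → MAny.Any P (f x)
  Any-mapMaybe⁻ (x ∷ xs) ps with f x in eq
  Any-mapMaybe⁻ (x ∷ xs) ps         | nothing = Any-mapMaybe⁻ xs ps
  Any-mapMaybe⁻ (x ∷ xs) (here p)   | just _ = x , subst (MAny.Any P) (sym eq) (MAny.just p)
  Any-mapMaybe⁻ (x ∷ xs) (there ps) | just _ = Any-mapMaybe⁻ xs ps

-- Names the function under a mapMaybe when it is local to another definition.
mapMaybe-function : ∀ {A B : Set} {f : A → Maybe B} xs ys → ys ≡ mapMaybe f xs → A → Maybe B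
mapMaybe-function {f = f} _ _ _ = f

-- Keeping or dropping the head mirrors the recursion of `nonEmptySublists`, and the member `x`
-- ensures that something is kept. It places a union of filtered support coalitions among the
-- coalitions of `Δ γ`.
filter-∈-nonEmptySublists : ∀ {A : Set} {P : Pred A 0ℓ} (P? : Decidable P) {x} xs →
  x ∈ˡ filter P? xs → filter P? xs ∈ˡ nonEmptySublists xs
filter-∈-nonEmptySublists P? (y ∷ ys) m with P? y
... | no _ = there (∈-++⁺ʳ _ (filter-∈-nonEmptySublists P? ys m))
... | yes _ with filter P? ys in eq
...   | [] = here refl
...   | z ∷ _ = there (∈-++⁺ˡ (∈-map⁺ (List._∷_ y) (subst (_∈ˡ nonEmptySublists ys) eq
                  (filter-∈-nonEmptySublists P? ys (subst (z ∈ˡ_) (sym eq) (here refl))))))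

∈-allCoalitions : ∀ {n} (C : Coalition n) → C ∈ˡ allCoalitions n
∈-allCoalitions Vec.[]               = here refl
∈-allCoalitions (inside  Vec.∷ C)    = ∈-++⁺ˡ (∈-map⁺ _ (∈-allCoalitions C))
∈-allCoalitions (outside Vec.∷ C)    = ∈-++⁺ʳ _ (∈-map⁺ _ (∈-allCoalitions C))

⊆-⋃ : ∀ {n} {C : Coalition n} {F} → C ∈ˡ F → C ⊆ ⋃ F
⊆-⋃ {F = C ∷ F} (here refl) = p⊆p∪q (⋃ F)
⊆-⋃ {F = D ∷ F} (there m)   = q⊆p∪q D (⋃ F) ∘ ⊆-⋃ m

⋃-⊆ : ∀ {n} {D : Coalition n} F → (∀ {C} → C ∈ˡ F → C ⊆ D) → ⋃ F ⊆ D
⋃-⊆ []      h a∈ = ⊥-elim (∉⊥ a∈)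
⋃-⊆ (C ∷ F) h a∈ with x∈p∪q⁻ C (⋃ F) a∈
... | inj₁ a∈C = h (here refl) a∈C
... | inj₂ a∈⋃ = ⋃-⊆ F (h ∘ there) a∈⋃

-- Goal assignments, their modifications and the unfolding.

module _ {n : ℕ} {AP : Set} where

  isTrivial⇒≡ : (θ : PathFormula n AP) → isTrivial θ ≡ true → θ ≡ X `⊤
  isTrivial⇒≡ (X `⊤) _ = refl

  trivial-or-support : ∀ (γ : GoalAssignment n AP) C → γ C ≡ X `⊤ ⊎ C ∈supp γ
  trivial-or-support γ C with isTrivial (γ C) in eq
  ... | true  = inj₁ (isTrivial⇒≡ (γ C) eq)
  ... | false = inj₂ refl

  LongTerm : PathFormula n AP → Set
  LongTerm θ = IsU θ ⊎ IsG θ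

  shape : (θ : PathFormula n AP) → (∃ λ φ → θ ≡ X φ) ⊎ LongTerm θ
  shape (X φ)   = inj₁ (φ , refl)
  shape (α U β) = inj₂ (inj₁ (α , β , refl))
  shape (G χ)   = inj₂ (inj₂ (χ , refl))

  LongTerm⇒support : ∀ (γ : GoalAssignment n AP) C → LongTerm (γ C) → C ∈supp γ
  LongTerm⇒support γ C (inj₁ (_ , _ , eq)) rewrite eq = refl
  LongTerm⇒support γ C (inj₂ (_ , eq))     rewrite eq = refl

  ▷-same : ∀ (γ : GoalAssignment n AP) C θ → (γ [ C ▷ θ ]) C ≡ θ
  ▷-same γ C θ with C ≟ᶜ C
  ... | yes _ = refl
  ... | no ¬p = contradiction refl ¬p

  ▷-other : ∀ (γ : GoalAssignment n AP) {C D} θ → D ≢ C → (γ [ C ▷ θ ]) D ≡ γ D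
  ▷-other γ {C} {D} θ D≢C with D ≟ᶜ C
  ... | yes p = contradiction p D≢C
  ... | no _  = refl

  ▷-elim : ∀ (R : Coalition n → PathFormula n AP → Set) (γ : GoalAssignment n AP) C θ D →
           R C θ → (D ≢ C → R D (γ D)) → R D ((γ [ C ▷ θ ]) D)
  ▷-elim R γ C θ D r₁ r₂ with D ≟ᶜ C
  ... | yes refl = r₁
  ... | no D≢C   = r₂ D≢C

  ∣-elim : ∀ (R : PathFormula n AP → Set) (γ : GoalAssignment n AP) C D →
           R (X `⊤) → (D ⊆ C → R (γ D)) → R ((γ ∣ C) D)
  ∣-elim R γ C D r₁ r₂ with D ⊆? C
  ... | yes D⊆C = r₂ D⊆C
  ... | no _    = r₁

  UG-LongTerm : ∀ (γ : GoalAssignment n AP) C → LongTerm (γ C) → (γ ∣UG) C ≡ γ C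
  UG-LongTerm γ C (inj₁ (_ , _ , eq)) with γ C | eq
  ... | _ U _ | refl = refl
  UG-LongTerm γ C (inj₂ (_ , eq)) with γ C | eq
  ... | G _ | refl = refl

  UG-elim : ∀ (R : PathFormula n AP → Set) (γ : GoalAssignment n AP) C →
            R (X `⊤) → (LongTerm (γ C) → R (γ C)) → R ((γ ∣UG) C)
  UG-elim R γ C r₁ r₂ with γ C
  ... | X _   = r₁
  ... | α U β = r₂ (inj₁ (α , β , refl))
  ... | G χ   = r₂ (inj₂ (χ , refl))

  ∣-inside : ∀ (γ : GoalAssignment n AP) {C D} → D ⊆ C → (γ ∣ C) D ≡ γ D
  ∣-inside γ {C} {D} D⊆C with D ⊆? C
  ... | yes _ = refl
  ... | no ¬p = contradiction (λ {x} → D⊆C {x}) ¬p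

  residual : GoalAssignment n AP → Coalition n → GoalAssignment n AP
  residual γ C = (γ ∣ C) ∣UG

  residual-LongTerm : ∀ γ {C D} → D ⊆ C → LongTerm (γ D) → residual γ C D ≡ γ D
  residual-LongTerm γ {C} {D} D⊆C lt = trans (UG-LongTerm (γ ∣ C) D
    (subst LongTerm (sym (∣-inside γ D⊆C)) lt)) (∣-inside γ D⊆C)

  residual-elim : ∀ (R : PathFormula n AP → Set) γ C D →
    R (X `⊤) → (D ⊆ C → LongTerm (γ D) → R (γ D)) → R (residual γ C D)
  residual-elim R γ C D r₁ r₂ = UG-elim R (γ ∣ C) D r₁
    (∣-elim (λ θ → LongTerm θ → R θ) γ C D (λ _ → r₁) r₂)

  ∈-support⁺ : ∀ {γ : GoalAssignment n AP} {C} → C ∈supp γ → C ∈ˡ support γ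
  ∈-support⁺ {γ} {C} = ∈-filter⁺ (_∈supp? γ) (∈-allCoalitions C)

  -- When `D` is the set of agents who followed a profile, every support coalition still owed its
  -- goal lies inside this coalition, so one promise of `Δ γ` covers them all.
  core : GoalAssignment n AP → Coalition n → Coalition n
  core γ D = ⋃ (filter (_⊆? D) (support γ))

  ⊆-core : ∀ {γ C D} → C ∈supp γ → C ⊆ D → C ⊆ core γ D
  ⊆-core {γ} {C} {D} C∈ C⊆D = ⊆-⋃ (∈-filter⁺ (_⊆? D) (∈-support⁺ {γ} C∈) (λ {x} → C⊆D {x}))

  core-⊆ : ∀ γ D → core γ D ⊆ D
  core-⊆ γ D = ⋃-⊆ (filter (_⊆? D) (support γ)) λ m → proj₂ (∈-filter⁻ (_⊆? D) {xs = support γ} m)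

  core-∈-unions : ∀ {γ C D} → C ∈supp γ → C ⊆ D → core γ D ∈ˡ unions {AP = AP} (support γ)
  core-∈-unions {γ} {C} {D} C∈ C⊆D = ∈-map⁺ ⋃ (filter-∈-nonEmptySublists (_⊆? D) (support γ)
    (∈-filter⁺ (_⊆? D) (∈-support⁺ {γ} C∈) (λ {x} → C⊆D {x})))

  open DecMembership (_≟ᶜ_ {n}) using () renaming (_∈?_ to _∈ˡ?_)

  successor : GoalAssignment n AP → Coalition n → StateFormula n AP
  successor γ C = foldr _`∧_ ⟨[ residual γ C ]⟩ (nextGoals γ C)

  Δ-union : ∀ γ {C} → C ∈ˡ unions {AP = AP} (support γ) → Δ γ C ≡ X (successor γ C)
  Δ-union γ {C} m with C ∈ˡ? unions {AP = AP} (support γ)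
  ... | yes _ = refl
  ... | no ¬m = contradiction m ¬m

  Δ-elim : ∀ (R : PathFormula n AP → Set) γ C → R (X (successor γ C)) → R (X `⊤) → R (Δ γ C)
  Δ-elim R γ C r₁ r₂ with C ∈ˡ? unions {AP = AP} (support γ)
  ... | yes _ = r₁
  ... | no _  = r₂

-- Truth of Boolean combinations at a state.

module _ (em : ExcludedMiddle 0ℓ) {n : ℕ} {AP : Set} (M : ConcurrentGameModel n AP) where
  open ConcurrentGameModel M
  open Plays M
  open Semantics M

  stable : {P : Set} → ¬ ¬ P → P
  stable = decidable-stable em

  ⇒⁺ : {P Q : Set} → (P → Q) → ¬ P ⊎ Q
  ⇒⁺ {P} h with em {P}
  ... | yes p = inj₂ (h p)
  ... | no ¬p = inj₁ ¬p

  ⇒⁻ : {P Q : Set} → ¬ P ⊎ Q → P → Q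
  ⇒⁻ (inj₁ ¬p) p = contradiction p ¬p
  ⇒⁻ (inj₂ q)  _ = q

  module _ {s : S} where

    ⋀⁺ : ∀ {ψ} Φ → All (s ⊩_) Φ → s ⊩ ψ → s ⊩ foldr _`∧_ ψ Φ
    ⋀⁺ []      []       q = q
    ⋀⁺ (_ ∷ Φ) (p ∷ ps) q = p , ⋀⁺ Φ ps q

    ⋀⁻ : ∀ {ψ} Φ → s ⊩ foldr _`∧_ ψ Φ → All (s ⊩_) Φ × s ⊩ ψ
    ⋀⁻ []      q        = [] , q
    ⋀⁻ (_ ∷ Φ) (p , ps) = p ∷ proj₁ (⋀⁻ Φ ps) , proj₂ (⋀⁻ Φ ps)

    ⋁⁺ : ∀ {ψ} Φ → Any (s ⊩_) Φ ⊎ s ⊩ ψ → s ⊩ foldr _`∨_ ψ Φ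
    ⋁⁺ []      (inj₂ q)          = q
    ⋁⁺ (_ ∷ Φ) (inj₁ (here p))   = inj₁ p
    ⋁⁺ (_ ∷ Φ) (inj₁ (there ps)) = inj₂ (⋁⁺ Φ (inj₁ ps))
    ⋁⁺ (_ ∷ Φ) (inj₂ q)          = inj₂ (⋁⁺ Φ (inj₂ q))

    ⋁⁻ : ∀ {ψ} Φ → s ⊩ foldr _`∨_ ψ Φ → Any (s ⊩_) Φ ⊎ s ⊩ ψ
    ⋁⁻ []      q        = inj₂ q
    ⋁⁻ (_ ∷ Φ) (inj₁ p) = inj₁ (here p)
    ⋁⁻ (_ ∷ Φ) (inj₂ r) with ⋁⁻ Φ r
    ... | inj₁ ps = inj₁ (there ps)
    ... | inj₂ q  = inj₂ q

    -- Excluded middle makes truth at `s` a valuation of the atoms, at which a propositional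
    -- tautology can be evaluated.
    truth : StateFormula n AP → Bool
    truth φ = ⌊ em {s ⊩ φ} ⌋

    truth⁻ : ∀ φ → truth φ ≡ true → s ⊩ φ
    truth⁻ φ eq with em {s ⊩ φ}
    ... | yes p = p

    truth⁻¬ : ∀ φ → truth φ ≡ false → ¬ s ⊩ φ
    truth⁻¬ φ eq with em {s ⊩ φ}
    ... | no ¬p = ¬p

    eval-true  : ∀ φ → eval truth φ ≡ true → s ⊩ φ
    eval-false : ∀ φ → eval truth φ ≡ false → ¬ s ⊩ φ

    eval-true (var p)      eq = truth⁻ (var p) eq
    eval-true `⊤           eq = tt
    eval-true (`¬ φ)       eq = eval-false φ (Bool.not-injective eq)
    eval-true (φ `∧ ψ)     eq with eval truth φ in e₁ | eval truth ψ in e₂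
    ... | true | true = eval-true φ e₁ , eval-true ψ e₂
    eval-true (φ `∨ ψ)     eq with eval truth φ in e₁ | eval truth ψ in e₂
    ... | true  | _    = inj₁ (eval-true φ e₁)
    ... | false | true = inj₂ (eval-true ψ e₂)
    eval-true (`goals γ ne) eq = truth⁻ (`goals γ ne) eq

    eval-false (var p)      eq = truth⁻¬ (var p) eq
    eval-false (`¬ φ)       eq = λ ¬p → ¬p (eval-true φ (Bool.not-injective eq))
    eval-false (φ `∧ ψ)     eq (p , q) with eval truth φ in e₁ | eval truth ψ in e₂
    ... | false | _     = eval-false φ e₁ p
    ... | true  | false = eval-false ψ e₂ q
    eval-false (φ `∨ ψ)     eq r with eval truth φ in e₁ | eval truth ψ in e₂
    ... | false | false = [ eval-false φ e₁ , eval-false ψ e₂ ]′ r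
    eval-false (`goals γ ne) eq = truth⁻¬ (`goals γ ne) eq

  -- Enforcing single goals and achieving assignments.

  ⊩ᵖ-resp : ∀ {π ρ} θ → (∀ i → π i ≡ ρ i) → ρ ⊩ᵖ θ → π ⊩ᵖ θ
  ⊩ᵖ-resp (X φ)   eq p           = subst (_⊩ φ) (sym (eq 1)) p
  ⊩ᵖ-resp (α U β) eq (i , q , p) =
    i , subst (_⊩ β) (sym (eq i)) q , λ j j<i → subst (_⊩ α) (sym (eq j)) (p j j<i)
  ⊩ᵖ-resp (G χ)   eq p i         = subst (_⊩ χ) (sym (eq i)) (p i)

  Enforces : StrategyProfile → S → Coalition n → PathFormula n AP → Set
  Enforces σ s C θ = ∀ σ′ → AgreeOn C σ σ′ → path σ′ s ⊩ᵖ θ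

  Achieves : StrategyProfile → S → GoalAssignment n AP → Set
  Achieves σ s γ = ∀ C → Enforces σ s C (γ C)

  AgreeOn-refl : ∀ C σ → AgreeOn C σ σ
  AgreeOn-refl C σ a _ h = refl

  AgreeOn-⊆ : ∀ {C D σ τ} → C ⊆ D → AgreeOn D σ τ → AgreeOn C σ τ
  AgreeOn-⊆ C⊆D agr a a∈C = agr a (C⊆D a∈C)

  AgreeOn-trans : ∀ {C ρ σ τ} → AgreeOn C ρ σ → AgreeOn C σ τ → AgreeOn C ρ τ
  AgreeOn-trans p q a a∈C h = trans (q a a∈C h) (p a a∈C h)

  defaultProfile : StrategyProfile
  defaultProfile a {w} h =
    let x , x∈act = GameForm.act-inhabit (𝔤 w) a in x , Irrelevant.[ x∈act ]

  abstract
    ⟨⟩⁺ : ∀ {s} γ σ → Achieves σ s γ → s ⊩ ⟨[ γ ]⟩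
    ⟨⟩⁺ γ σ ach with anySubset? (_∈supp? γ)
    ... | yes _ = σ , λ C π (σ′ , agr , eq) → ⊩ᵖ-resp (γ C) eq (ach C σ′ agr)
    ... | no _  = tt

    -- With empty support the formula collapses to truth and contains no profile; then every goal is
    -- trivial and the default profile achieves them all.
    ⟨⟩⁻ : ∀ {s} γ → s ⊩ ⟨[ γ ]⟩ → Σ StrategyProfile λ σ → Achieves σ s γ
    ⟨⟩⁻ {s} γ p with anySubset? (_∈supp? γ)
    ⟨⟩⁻ {s} γ (σ , ach) | yes _ = σ , λ C σ′ agr → ach C (path σ′ s) (σ′ , agr , λ _ → refl)
    ... | no ¬ne = defaultProfile , trivial
      where
      trivial : Achieves defaultProfile s γ
      trivial C σ′ _ with trivial-or-support γ C
      ... | inj₁ eq = subst (path σ′ s ⊩ᵖ_) (sym eq) tt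
      ... | inj₂ C∈ = contradiction (C , C∈) ¬ne

  -- Plays after their first step.

  prepend : ∀ s → 𝔤.ActionProfile s → ∀ {w} → History w → History w
  prepend s ζ (start w)      = start s ▸ ζ ▸ w
  prepend s ζ (h ▸ ξ ▸ w)    = prepend s ζ h ▸ ξ ▸ w

  shift : ∀ s → 𝔤.ActionProfile s → StrategyProfile → StrategyProfile
  shift s ζ σ a h = σ a (prepend s ζ h)

  opening : StrategyProfile → ∀ s → 𝔤.ActionProfile s
  opening σ s = move σ (start s)

  move-cong : ∀ {σ τ} → (∀ a {w} (h : History w) → σ a h ≡ τ a h) →
              ∀ {w} (h : History w) → move σ h ≡ move τ h
  move-cong eq h = value-injective (tabulate-cong λ a → cong value (eq a h))

  extend : StrategyProfile → ∃ History → ∃ History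
  extend σ (v , h) = let v′ = 𝔤.out v (move σ h) in v′ , (h ▸ move σ h ▸ v′)

  play-cong : ∀ {σ τ} → (∀ a {w} (h : History w) → σ a h ≡ τ a h) →
              ∀ s i → play σ s i ≡ play τ s i
  play-cong         eq s zero    = refl
  play-cong {σ} {τ} eq s (suc i) = trans (cong (extend σ) (play-cong {σ} {τ} eq s i))
    (let v , h = play τ s i in
     cong (λ ζ → 𝔤.out v ζ , (h ▸ ζ ▸ 𝔤.out v ζ)) (move-cong {σ} {τ} eq h))

  -- `shift` consults `σ` on the history with the first step put back, so both plays are extended by
  -- the same moves.
  play-suc : ∀ σ s i → let v , h = play (shift s (opening σ s) σ) (𝔤.out s (opening σ s)) i in
             play σ s (suc i) ≡ (v , prepend s (opening σ s) h)
  play-suc σ s zero    = refl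
  play-suc σ s (suc i) = cong (extend σ) (play-suc σ s i)

  path-suc : ∀ σ s i → path σ s (suc i) ≡ path (shift s (opening σ s) σ) (𝔤.out s (opening σ s)) i
  path-suc σ s i = cong proj₁ (play-suc σ s i)

  -- Profiles defined by recursion along the play.

  -- Histories read from their first state, so that strategies can be defined
  -- by recursion along the play.
  data Trace : S → S → Set where
    []  : ∀ {w} → Trace w w
    _∷_ : ∀ {v u w} → 𝔤.ActionProfile v → Trace u w → Trace v w

  _∷ʳ[_]_ : ∀ {v u} → Trace v u → 𝔤.ActionProfile u → ∀ w → Trace v w
  []      ∷ʳ[ ξ ] w = ξ ∷ []
  (ζ ∷ t) ∷ʳ[ ξ ] w = ζ ∷ (t ∷ʳ[ ξ ] w)

  split : ∀ {w} → History w → ∃ λ v → Trace v w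
  split (start w)   = w , []
  split (h ▸ ξ ▸ w) = let v , t = split h in v , (t ∷ʳ[ ξ ] w)

  join : ∀ {v w} → Trace v w → History w
  join []            = start _
  join (_∷_ {v} ζ t) = prepend v ζ (join t)

  join-∷ʳ : ∀ {v u} (t : Trace v u) ξ w → join (t ∷ʳ[ ξ ] w) ≡ join t ▸ ξ ▸ w
  join-∷ʳ []            ξ w = refl
  join-∷ʳ (_∷_ {v} ζ t) ξ w = cong (prepend v ζ) (join-∷ʳ t ξ w)

  join-split : ∀ {w} (h : History w) → join (proj₂ (split h)) ≡ h
  join-split (start w)   = refl
  join-split (h ▸ ξ ▸ w) = trans (join-∷ʳ (proj₂ (split h)) ξ w) (cong (_▸ ξ ▸ w) (join-split h))

  split-prepend : ∀ s ζ {w} (h : History w) → split (prepend s ζ h) ≡ (s , ζ ∷ proj₂ (split h))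
  split-prepend s ζ (start w) = refl
  split-prepend s ζ (h ▸ ξ ▸ w) rewrite split-prepend s ζ h = refl

  -- A strategy profile in the making: a mode at s prescribes the actions at s,
  -- and after the step ζ either another mode or a complete profile takes over.
  record Controller : Set₁ where
    field
      Mode  : S → Set
      first : ∀ {s} → Mode s → StrategyProfile
      next  : ∀ {s} → Mode s → (ζ : 𝔤.ActionProfile s) → Mode (𝔤.out s ζ) ⊎ StrategyProfile

  module Unroll (K : Controller) where
    open Controller K

    unrollᵗ : ∀ {s} → Mode s → ∀ a {v w} → Trace v w → Refinement Act (𝔤.act w a)
    unrollᵗ q a [] = first q a (start _)
    unrollᵗ {s} q a (_∷_ {v} ζ t) with em {v ≡ s}
    ... | no _ = first q a (prepend v ζ (join t))
    ... | yes refl with next q ζ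
    ...   | inj₁ q′ = unrollᵗ q′ a t
    ...   | inj₂ τ  = τ a (join t)

    -- Histories that do not begin at s, irrelevant for plays from s, are
    -- answered by first q; this makes AgreeOn provable for unrolled profiles.
    unroll : ∀ {s} → Mode s → StrategyProfile
    unroll q a h = unrollᵗ q a (proj₂ (split h))

    after : ∀ {s} → Mode s → 𝔤.ActionProfile s → StrategyProfile
    after q ζ = [ unroll , id ]′ (next q ζ)

    shift-unroll : ∀ {s} (q : Mode s) ζ a {w} (h : History w) →
                   shift s ζ (unroll q) a h ≡ after q ζ a h
    shift-unroll {s} q ζ a h rewrite split-prepend s ζ h with em {s ≡ s}
    ... | no ¬p = contradiction refl ¬p
    ... | yes refl with next q ζ
    ...   | inj₁ _ = refl
    ...   | inj₂ τ = cong (τ a) (join-split h)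

    -- It suffices to check each handover: if whatever takes over agrees on `C` with the remainder
    -- of the current profile, these agreements compose along the trace.
    unroll-agree : ∀ {C} →
      (∀ {s} (q : Mode s) ζ → AgreeOn C (shift s ζ (first q)) ([ first , id ]′ (next q ζ))) →
      ∀ {s} (q : Mode s) → AgreeOn C (first q) (unroll q)
    unroll-agree {C} step q a a∈C h =
      trans (go q (proj₂ (split h))) (cong (λ h → first q a h) (join-split h))
      where
      go : ∀ {s} (q : Mode s) → ∀ {v w} (t : Trace v w) → unrollᵗ q a t ≡ first q a (join t)
      go q [] = refl
      go {s} q (_∷_ {v} ζ t) with em {v ≡ s}
      ... | no _ = refl
      ... | yes refl with next q ζ | step q ζ
      ...   | inj₁ q′ | agr = trans (go q′ t) (agr a a∈C (join t))
      ...   | inj₂ τ  | agr = agr a a∈C (join t)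

    path-unroll : ∀ {s} (q : Mode s) i → path (unroll q) s (suc i) ≡
      path (after q (opening (first q) s)) (𝔤.out s (opening (first q) s)) i
    path-unroll {s} q i = trans (path-suc (unroll q) s i)
      (cong proj₁ (play-cong {shift s ζ (unroll q)} {after q ζ} (shift-unroll q ζ) (𝔤.out s ζ) i))
      where ζ = opening (first q) s

    -- The step taken is the opening of `σ′`, which may differ from that of `first q` for agents
    -- outside `C`; this is why `next` must respond to every `ζ`.
    path-follow : ∀ {s C σ′} (q : Mode s) → AgreeOn C (unroll q) σ′ →
      let ζ = opening σ′ s in AgreeOn C (after q ζ) (shift s ζ σ′)
    path-follow {s} {σ′ = σ′} q agr a a∈C h =
      trans (agr a a∈C _) (shift-unroll q (opening σ′ s) a h)

  open Unroll

  -- Replacing continuations and deviating at the first step.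

  gluing : Coalition n → Controller
  gluing C = record
    { Mode  = λ s → ∃₂ λ (σ : StrategyProfile) (k : 𝔤.ActionProfile s → StrategyProfile) →
                    ∀ ζ → AgreeOn C (shift s ζ σ) (k ζ)
    ; first = proj₁
    ; next  = λ (_ , k , _) ζ → inj₂ (k ζ)
    }

  abstract
    -- After the opening of `σ` the new profile switches to `τ`; after any other step it goes on
    -- with `σ`, so the agreement on `C` holds on all histories. This turns a profile for the
    -- successor state into one for `s`.
    splice : ∀ {C s σ τ} → AgreeOn C (shift s (opening σ s) σ) τ →
      ∃ λ σ⁺ → AgreeOn C σ σ⁺ × (∀ i → path σ⁺ s (suc i) ≡ path τ (𝔤.out s (opening σ s)) i)
    splice {C} {s} {σ} {τ} agr =
      unroll (gluing C) q , unroll-agree (gluing C) (λ (_ , _ , agr) → agr) q ,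
      λ i → trans (path-unroll (gluing C) q i) (cong (λ ρ → path ρ _ i) chosen)
      where
      choose : ∀ ζ → ∃ λ ρ → AgreeOn C (shift s ζ σ) ρ × (ζ ≡ opening σ s → ρ ≡ τ)
      choose ζ with em {ζ ≡ opening σ s}
      ... | yes refl = τ , agr , λ _ → refl
      ... | no ζ≢    = shift s ζ σ , AgreeOn-refl C (shift s ζ σ) , λ eq → contradiction eq ζ≢

      q : Controller.Mode (gluing C) s
      q = σ , (λ ζ → proj₁ (choose ζ)) , (λ ζ → proj₁ (proj₂ (choose ζ)))

      chosen : proj₁ (choose (opening σ s)) ≡ τ
      chosen = proj₂ (proj₂ (choose (opening σ s))) refl

  followers : StrategyProfile → ∀ s → 𝔤.ActionProfile s → Coalition n
  followers σ s ζ = tabulate λ a → ⌊ em {lookup (value ζ) a ≡ value (σ a (start s))} ⌋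

  ∈-followers⁺ : ∀ {σ s ζ a} → lookup (value ζ) a ≡ value (σ a (start s)) → a ∈ followers σ s ζ
  ∈-followers⁺ {σ} {s} {ζ} {a} eq = lookup⇒[]= a _ (trans (lookup∘tabulate _ a) holds)
    where
    holds : ⌊ em {lookup (value ζ) a ≡ value (σ a (start s))} ⌋ ≡ true
    holds with em {lookup (value ζ) a ≡ value (σ a (start s))}
    ... | yes _ = refl
    ... | no ¬p = contradiction eq ¬p

  ∈-followers⁻ : ∀ {σ s ζ a} → a ∈ followers σ s ζ → lookup (value ζ) a ≡ value (σ a (start s))
  ∈-followers⁻ {σ} {s} {ζ} {a} a∈ = holds (trans (sym (lookup∘tabulate _ a)) ([]=⇒lookup a∈))
    where
    holds : ⌊ em {lookup (value ζ) a ≡ value (σ a (start s))} ⌋ ≡ true →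
            lookup (value ζ) a ≡ value (σ a (start s))
    holds eq with em {lookup (value ζ) a ≡ value (σ a (start s))}
    ... | yes p = p

  AgreeOn⇒⊆-followers : ∀ {C σ σ′} s → AgreeOn C σ σ′ → C ⊆ followers σ s (opening σ′ s)
  AgreeOn⇒⊆-followers {σ = σ} {σ′} s agr {a} a∈C = ∈-followers⁺ {σ} {s} {opening σ′ s}
    (trans (lookup∘tabulate (λ a → value (σ′ a (start s))) a) (cong value (agr a a∈C (start s))))

  deviating : ∀ s → 𝔤.ActionProfile s → StrategyProfile → StrategyProfile
  deviating s ζ σ a (start w) with em {w ≡ s}
  ... | yes refl = lookup (value ζ) a , Irrelevant.map (λ p → p a) (proof ζ)
  ... | no _     = σ a (start w)
  deviating s ζ σ a h@(_ ▸ _ ▸ _) = σ a h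

  opening-deviating : ∀ s ζ σ → opening (deviating s ζ σ) s ≡ ζ
  opening-deviating s ζ σ =
    value-injective (trans (tabulate-cong at-start) (tabulate∘lookup (value ζ)))
    where
    at-start : ∀ a → value (deviating s ζ σ a (start s)) ≡ lookup (value ζ) a
    at-start a with em {s ≡ s}
    ... | yes refl = refl
    ... | no ¬p    = contradiction refl ¬p

  deviating-agree : ∀ s ζ σ → AgreeOn (followers σ s ζ) σ (deviating s ζ σ)
  deviating-agree s ζ σ a a∈ (start w) with em {w ≡ s}
  ... | yes refl = value-injective (∈-followers⁻ {σ} {s} {ζ} a∈)
  ... | no _     = refl
  deviating-agree s ζ σ a a∈ (_ ▸ _ ▸ _) = refl

  -- Every `ζ` is the opening of `deviating s ζ σ`, which agrees with `σ` on the followers, so the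
  -- enforced goal applies to the step `ζ`.
  enforces-next : ∀ {σ s C ψ} ζ → Enforces σ s C (X ψ) → C ⊆ followers σ s ζ → 𝔤.out s ζ ⊩ ψ
  enforces-next {σ} {s} {C} {ψ} ζ enf C⊆ = subst (λ ξ → 𝔤.out s ξ ⊩ ψ) (opening-deviating s ζ σ)
    (enf (deviating s ζ σ) (AgreeOn-⊆ {σ = σ} C⊆ (deviating-agree s ζ σ)))

  -- Members of the formula lists in the unfolding.

  module _ (γ : GoalAssignment n AP) {s : S} where

    private
      finishOf : Coalition n → Maybe (StateFormula n AP)
      finishOf = mapMaybe-function (allCoalitions n) (Finish γ) refl

      holdsOfU holdsOfG : Coalition n → Maybe (StateFormula n AP)
      holdsOfU = mapMaybe-function (allCoalitions n) (UHolds γ) refl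
      holdsOfG = mapMaybe-function (allCoalitions n) (GHolds γ) refl

      nextOf : Coalition n → Coalition n → Maybe (StateFormula n AP)
      nextOf C = mapMaybe-function (filter (_⊆? C) (support γ)) (nextGoals γ C) refl

    Finish⁺ : ∀ {C α β} → γ C ≡ α U β → s ⊩ β → s ⊩ ⟨[ γ ∖ C ]⟩ → Any (s ⊩_) (Finish γ)
    Finish⁺ {C} {α} {β} eq q r =
      Any-mapMaybe⁺ {f = finishOf} (allCoalitions n) (∈-allCoalitions C) (at eq)
      where
      at : γ C ≡ α U β → MAny.Any (s ⊩_) (finishOf C)
      at eq with γ C | eq
      ... | _ | refl = MAny.just (q , r)

    Finish⁻ : Any (s ⊩_) (Finish γ) → ∃ λ C → ∃₂ λ α β → γ C ≡ α U β × s ⊩ β × s ⊩ ⟨[ γ ∖ C ]⟩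
    Finish⁻ any with Any-mapMaybe⁻ {f = finishOf} (allCoalitions n) any
    ... | C , p = C , at C p
      where
      at : ∀ C → MAny.Any (s ⊩_) (finishOf C) →
           ∃₂ λ α β → γ C ≡ α U β × s ⊩ β × s ⊩ ⟨[ γ ∖ C ]⟩
      at C p with γ C
      at C (MAny.just (q , r)) | α U β = α , β , refl , q , r

    UHolds⁺ : (∀ C α β → γ C ≡ α U β → s ⊩ α) → All (s ⊩_) (UHolds γ)
    UHolds⁺ h = All-mapMaybe⁺ {f = holdsOfU} (allCoalitions n) at
      where
      at : ∀ C → MAll.All (s ⊩_) (holdsOfU C)
      at C with γ C in eq
      ... | X _   = MAll.nothing
      ... | α U β = MAll.just (h C α β eq)
      ... | G _   = MAll.nothing

    UHolds⁻ : All (s ⊩_) (UHolds γ) → ∀ {C α β} → γ C ≡ α U β → s ⊩ α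
    UHolds⁻ all {C} eq
      with γ C | eq | All-mapMaybe⁻ {f = holdsOfU} (allCoalitions n) all (∈-allCoalitions C)
    ... | _ | refl | MAll.just p = p

    GHolds⁺ : (∀ C χ → γ C ≡ G χ → s ⊩ χ) → All (s ⊩_) (GHolds γ)
    GHolds⁺ h = All-mapMaybe⁺ {f = holdsOfG} (allCoalitions n) at
      where
      at : ∀ C → MAll.All (s ⊩_) (holdsOfG C)
      at C with γ C in eq
      ... | X _   = MAll.nothing
      ... | _ U _ = MAll.nothing
      ... | G χ   = MAll.just (h C χ eq)

    GHolds⁻ : All (s ⊩_) (GHolds γ) → ∀ {C χ} → γ C ≡ G χ → s ⊩ χ
    GHolds⁻ all {C} eq
      with γ C | eq | All-mapMaybe⁻ {f = holdsOfG} (allCoalitions n) all (∈-allCoalitions C)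
    ... | _ | refl | MAll.just p = p

    nextGoals⁺ : ∀ D → (∀ C φ → C ⊆ D → γ C ≡ X φ → s ⊩ φ) → All (s ⊩_) (nextGoals γ D)
    nextGoals⁺ D h = All.mapMaybe⁺ {f = nextOf D} (All.map⁺ (All.tabulate at))
      where
      at : ∀ {C} → C ∈ˡ filter (_⊆? D) (support γ) → MAll.All (s ⊩_) (nextOf D C)
      at {C} m with γ C in eq
      ... | X φ   = MAll.just (h C φ (proj₂ (∈-filter⁻ (_⊆? D) {xs = support γ} m)) eq)
      ... | _ U _ = MAll.nothing
      ... | G _   = MAll.nothing

    nextGoals⁻ : ∀ D → All (s ⊩_) (nextGoals γ D) →
                 ∀ {C φ} → C ∈supp γ → C ⊆ D → γ C ≡ X φ → s ⊩ φ
    nextGoals⁻ D all {C} {φ} C∈ C⊆D eq = at eq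
      (All-mapMaybe⁻ {f = nextOf D} (filter (_⊆? D) (support γ)) all
        (∈-filter⁺ (_⊆? D) (∈-support⁺ {γ = γ} C∈) (λ {x} → C⊆D {x})))
      where
      at : γ C ≡ X φ → MAll.All (s ⊩_) (nextOf D C) → s ⊩ φ
      at eq p with γ C | eq
      at eq (MAll.just p) | _ | refl = p

  -- Passing goals through one step of a play.

  Pending : GoalAssignment n AP → S → Set
  Pending γ s = ∀ C α β → γ C ≡ α U β → ¬ s ⊩ β

  -- The witness of an until-goal not fulfilled now has positive index and moves down by one; an
  -- always-goal passes to every suffix.
  progress : ∀ {π} θ → (∀ α β → θ ≡ α U β → ¬ π 0 ⊩ β) → LongTerm θ → π ⊩ᵖ θ → (π ∘ suc) ⊩ᵖ θ
  progress (X _)   _    (inj₁ (_ , _ , ()))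
  progress (X _)   _    (inj₂ (_ , ()))
  progress (α U β) ¬now _ (zero  , q , _) = contradiction q (¬now α β refl)
  progress (α U β) ¬now _ (suc i , q , p) = i , q , λ j j<i → p (suc j) (s<s j<i)
  progress (G χ)   _    _ p i             = p (suc i)

  -- The listed conjuncts supply what index zero of the longer path requires: the left side of an
  -- until-goal or the body of an always-goal.
  regress : ∀ {π} γ → All (π 0 ⊩_) (UHolds γ ++ GHolds γ) → ∀ C → LongTerm (γ C) →
            (π ∘ suc) ⊩ᵖ γ C → π ⊩ᵖ γ C
  regress {π} γ all C (inj₁ (α , β , eq)) p = subst (π ⊩ᵖ_) (sym eq)
    (case subst ((π ∘ suc) ⊩ᵖ_) eq p of λ (i , q , p) →
      suc i , q , λ { zero _ → UHolds⁻ γ (All.++⁻ˡ (UHolds γ) all) eq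
                    ; (suc j) (s≤s j<i) → p j j<i })
  regress {π} γ all C (inj₂ (χ , eq)) p = subst (π ⊩ᵖ_) (sym eq)
    λ { zero    → GHolds⁻ γ (All.++⁻ʳ (UHolds γ) all) eq
      ; (suc i) → subst ((π ∘ suc) ⊩ᵖ_) eq p i }

  module _ {γ : GoalAssignment n AP} {s : S} {σ : StrategyProfile} (ach : Achieves σ s γ) where

    own-path : ∀ {C θ} → γ C ≡ θ → path σ s ⊩ᵖ θ
    own-path {C} eq = subst (path σ s ⊩ᵖ_) eq (ach C σ (AgreeOn-refl C σ))

    abstract
      achieves-finish : ∀ {C α β} → γ C ≡ α U β → s ⊩ β → Any (s ⊩_) (Finish γ)
      achieves-finish {C} eq q = Finish⁺ γ eq q (⟨⟩⁺ (γ ∖ C) σ λ D →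
        ▷-elim (Enforces σ s) γ C (X `⊤) D (λ _ _ → tt) (λ _ → ach D))

      achieves-holds : Pending γ s → All (s ⊩_) (UHolds γ ++ GHolds γ)
      achieves-holds pending = All.++⁺
        (UHolds⁺ γ λ C α β eq → case own-path eq of λ
          { (zero  , q , _) → contradiction q (pending C α β eq)
          ; (suc i , _ , p) → p 0 z<s })
        (GHolds⁺ γ λ C χ eq → own-path eq 0)

      -- A profile `τ` that agrees on `D` with the rest of `σ′` is spliced behind the first move of
      -- `σ′`. The result agrees with `σ` on `D`, so its play meets the goal of `D`, and `progress`
      -- carries that to the tail.
      achieves-residual : Pending γ s → ∀ {C σ′} → AgreeOn C σ σ′ →
        Achieves (shift s (opening σ′ s) σ′) (𝔤.out s (opening σ′ s)) (residual γ C)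
      achieves-residual pending {C} {σ′} agr D = residual-elim (Enforces _ _ D) γ C D (λ _ _ → tt)
        λ D⊆C long τ agrτ →
          let σ⁺ , agr⁺ , eq = splice {D} {s} {σ′} {τ} agrτ
          in ⊩ᵖ-resp (γ D) (sym ∘ eq) (progress (γ D) (pending D) long
               (ach D σ⁺ (AgreeOn-trans {ρ = σ} {σ′} {σ⁺} (AgreeOn-⊆ {σ = σ} {σ′} D⊆C agr) agr⁺)))

      achieves-Δ : Pending γ s → Achieves σ s (Δ γ)
      achieves-Δ pending C = Δ-elim (Enforces σ s C) γ C
        (λ σ′ agr → ⋀⁺ (nextGoals γ C)
          (nextGoals⁺ γ C λ D φ D⊆C eq →
            subst (path σ′ s ⊩ᵖ_) eq (ach D σ′ (AgreeOn-⊆ {σ = σ} {σ′} D⊆C agr)))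
          (⟨⟩⁺ (residual γ C) _ (achieves-residual pending agr)))
        (λ _ _ → tt)

  -- The obligations after the step `ζ`: only coalitions of followers keep a claim, with nexttime
  -- goals on the state reached and long-term goals on the profile `τ` played from it.
  Answers : GoalAssignment n AP → StrategyProfile →
            ∀ {s} → 𝔤.ActionProfile s → StrategyProfile → Set
  Answers γ σ {s} ζ τ = ∀ {C} → C ∈supp γ → C ⊆ followers σ s ζ →
    (∀ {φ} → γ C ≡ X φ → 𝔤.out s ζ ⊩ φ) × (LongTerm (γ C) → Enforces τ (𝔤.out s ζ) C (γ C))

  abstract
    answer : ∀ γ σ {s} ζ → 𝔤.out s ζ ⊩ successor γ (core γ (followers σ s ζ)) → ∃ (Answers γ σ ζ)
    answer γ σ {s} ζ p =
      let D       = core γ (followers σ s ζ)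
          all , q = ⋀⁻ (nextGoals γ D) p
          τ , ach = ⟨⟩⁻ (residual γ D) q
      in τ , λ {C} C∈ C⊆ → let C⊆D = ⊆-core {γ = γ} C∈ C⊆ in
         nextGoals⁻ γ D all C∈ C⊆D ,
         λ long → subst (Enforces τ (𝔤.out s ζ) C) (residual-LongTerm γ C⊆D long) (ach C)

    -- If the core is no coalition of `Δ γ`, no support coalition lies within the followers, nothing
    -- is owed and `σ` is an arbitrary choice. The hypothesis concerns the core alone, so it also
    -- serves `Δ γ ⟪ φ ⟫` wherever that agrees with `Δ γ`.
    respond : ∀ γ σ {s} ζ →
      (let D = core γ (followers σ s ζ) in Enforces σ s D (Δ γ D)) → ∃ (Answers γ σ ζ)
    respond γ σ {s} ζ enf = case em {D ∈ˡ unions {AP = AP} (support γ)} of λ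
      { (no ∉)   → σ , λ C∈ C⊆ → contradiction (core-∈-unions {γ = γ} C∈ C⊆) ∉
      ; (yes D∈) → answer γ σ ζ (enforces-next {σ} {ψ = successor γ D} ζ
                     (subst (Enforces σ s D) (Δ-union γ D∈) enf) (core-⊆ γ (followers σ s ζ))) }
      where
      D : Coalition n
      D = core γ (followers σ s ζ)

  -- The fixpoint axiom.

  -- When no formula of `Finish γ` holds, every until-goal is pending, and the profile that achieves
  -- `γ` also achieves `Δ γ`.
  Fix⁺ : ∀ γ {s} → s ⊩ ⟨[ γ ]⟩ → s ⊩ unfold γ
  Fix⁺ γ {s} p with ⟨⟩⁻ γ p | em {Any (s ⊩_) (Finish γ)}
  ... | _ , _   | yes any = ⋁⁺ (Finish γ) (inj₁ any)
  ... | σ , ach | no ¬any = ⋁⁺ (Finish γ) (inj₂ (⋀⁺ (UHolds γ ++ GHolds γ)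
          (achieves-holds ach pending) (⟨⟩⁺ (Δ γ) σ (achieves-Δ ach pending))))
    where
    abstract
      pending : Pending γ s
      pending C α β eq q = ¬any (achieves-finish ach eq q)

  module FixStrategy (γ : GoalAssignment n AP) where

    controller : Controller
    controller = record
      { Mode  = λ s → ∃ λ σ → Achieves σ s (Δ γ)
      ; first = proj₁
      ; next  = λ (σ , ach) ζ → inj₂ (proj₁ (respond γ σ ζ (ach _)))
      }

    achieves : ∀ {s} (q : Controller.Mode controller s) →
               All (s ⊩_) (UHolds γ ++ GHolds γ) → Achieves (unroll controller q) s γ
    achieves {s} q@(σ , ach) all C σ′ agr with trivial-or-support γ C
    ... | inj₁ eq = subst (path σ′ s ⊩ᵖ_) (sym eq) tt
    -- By computation the unrolled profile opens like `σ`, so a coalition that agrees with it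
    -- consists of followers of `σ`.
    ... | inj₂ C∈ with proj₂ (respond γ σ (opening σ′ s) (ach _)) C∈
                         (AgreeOn⇒⊆-followers {σ = unroll controller q} {σ′} s agr) | shape (γ C)
    ... | atNext , _ | inj₁ (φ , eq) = subst (path σ′ s ⊩ᵖ_) (sym eq) (atNext eq)
    ... | _ , later  | inj₂ long     = regress γ all C long (⊩ᵖ-resp (γ C) (path-suc σ′ s)
            (later long _ (path-follow controller {σ′ = σ′} q agr)))

  Fix⁻ : ∀ γ {s} → s ⊩ unfold γ → s ⊩ ⟨[ γ ]⟩
  Fix⁻ γ {s} p with ⋁⁻ (Finish γ) p
  ... | inj₁ any =
    let C , α , β , eq , q , r = Finish⁻ γ any
        σ , ach = ⟨⟩⁻ (γ ∖ C) r
    in ⟨⟩⁺ γ σ λ D → case D ≟ᶜ C of λ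
         -- The goal of `C` is fulfilled at index zero of every play; the other goals are those of
         -- `γ ∖ C`.
         { (yes refl) → subst (Enforces σ s C) (sym eq) (λ _ _ → 0 , q , λ _ ())
         ; (no D≢C)   → subst (Enforces σ s D) (▷-other γ (X `⊤) D≢C) (ach D) }
  ... | inj₂ r =
    let all , p = ⋀⁻ (UHolds γ ++ GHolds γ) r
    in ⟨⟩⁺ γ _ (FixStrategy.achieves γ (⟨⟩⁻ (Δ γ) p) all)

  -- The coinduction rule.

  module CoInduction (γ : GoalAssignment n AP) (φ : StateFormula n AP) (typeG : TypeG γ)
                     (hyp : ∀ s → s ⊩ φ → s ⊩ ind γ φ) where

    no-Finish : ∀ {s} → ¬ Any (s ⊩_) (Finish γ)
    no-Finish any with Finish⁻ γ any
    ... | C , α , β , eq , _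
      with _ , eq′ ← proj₂ typeG C (LongTerm⇒support γ C (inj₁ (α , β , eq)))
      with () ← trans (sym eq) eq′

    abstract
      unfolded : ∀ {s} → s ⊩ φ → All (s ⊩_) (UHolds γ ++ GHolds γ) × s ⊩ ⟨[ Δ γ ⟪ φ ⟫ ]⟩
      unfolded p with ⋁⁻ (Finish γ) (hyp _ p)
      ... | inj₁ any = contradiction any no-Finish
      ... | inj₂ r   = ⋀⁻ (UHolds γ ++ GHolds γ) r

    firstᵩ : ∀ {s} → s ⊩ φ → StrategyProfile
    firstᵩ p = proj₁ (⟨⟩⁻ (Δ γ ⟪ φ ⟫) (proj₂ (unfolded p)))

    Sound : ∀ {s} → s ⊩ φ → (ζ : 𝔤.ActionProfile s) → (𝔤.out s ζ ⊩ φ) ⊎ StrategyProfile → Set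
    Sound p ζ (inj₁ _) = Unit
    Sound p ζ (inj₂ τ) = Answers γ (firstᵩ p) ζ τ

    abstract
      -- `Δ γ ⟪ φ ⟫` differs from `Δ γ` only at the union of the support. If the core is that union,
      -- the state reached satisfies `φ` and the mode continues; otherwise `respond` supplies a
      -- complete profile.
      nextᵩ : ∀ {s} (p : s ⊩ φ) ζ → ∃ (Sound p ζ)
      nextᵩ {s} p ζ = case D ≟ᶜ ⋃ (support γ) of λ
        { (yes eq) → inj₁ (enforces-next {firstᵩ p} {ψ = φ} ζ
            (subst (Enforces (firstᵩ p) s D)
              (trans (cong (Δ γ ⟪ φ ⟫) eq) (▷-same (Δ γ) (⋃ (support γ)) (X φ))) enf)
            (core-⊆ γ (followers (firstᵩ p) s ζ))) , tt
        ; (no ≢) → let τ , ans = respond γ (firstᵩ p) ζ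
                         (subst (Enforces (firstᵩ p) s D) (▷-other (Δ γ) (X φ) ≢) enf)
                   in inj₂ τ , λ {C} → ans {C} }
        where
        D : Coalition n
        D = core γ (followers (firstᵩ p) s ζ)

        enf : Enforces (firstᵩ p) s D (Δ γ ⟪ φ ⟫ D)
        enf = proj₂ (⟨⟩⁻ (Δ γ ⟪ φ ⟫) (proj₂ (unfolded p))) D

    controller : Controller
    controller = record { Mode = _⊩ φ ; first = firstᵩ ; next = λ p ζ → proj₁ (nextᵩ p ζ) }

    -- Induction on the index, as the mode may continue forever: `χ` holds at each `φ`-state by the
    -- hypothesis of the rule, and after a handover the answering profile enforces the goal.
    always : ∀ {C χ} → γ C ≡ G χ → ∀ i {s} (p : s ⊩ φ) σ′ →
             AgreeOn C (unroll controller p) σ′ → path σ′ s i ⊩ χ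
    always eq zero p σ′ agr = GHolds⁻ γ (All.++⁻ʳ (UHolds γ) (proj₁ (unfolded p))) eq
    always {C} {χ} eq (suc i) {s} p σ′ agr = subst (_⊩ χ) (sym (path-suc σ′ s i))
      (continue (proj₁ (nextᵩ p ζ)) (proj₂ (nextᵩ p ζ)) (path-follow controller {σ′ = σ′} p agr))
      where
      ζ = opening σ′ s

      continue : ∀ r → Sound p ζ r → AgreeOn C ([ unroll controller , id ]′ r) (shift s ζ σ′) →
                 path (shift s ζ σ′) (𝔤.out s ζ) i ⊩ χ
      continue (inj₁ p′) _   agr′ = always eq i p′ (shift s ζ σ′) agr′
      continue (inj₂ τ)  ans agr′ = subst (path (shift s ζ σ′) (𝔤.out s ζ) ⊩ᵖ_) eq
        (proj₂ (ans (LongTerm⇒support γ C (inj₂ (χ , eq)))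
                    (AgreeOn⇒⊆-followers {σ = unroll controller p} {σ′} s agr))
               (inj₂ (χ , eq)) (shift s ζ σ′) agr′) i

    achieves : ∀ {s} (p : s ⊩ φ) → Achieves (unroll controller p) s γ
    achieves {s} p C σ′ agr with trivial-or-support γ C
    ... | inj₁ eq = subst (path σ′ s ⊩ᵖ_) (sym eq) tt
    ... | inj₂ C∈ = let χ , eq = proj₂ typeG C C∈ in
      subst (path σ′ s ⊩ᵖ_) (sym eq) λ i → always eq i p σ′ agr

  -- The induction rule.

  module Induction (γ : GoalAssignment n AP) (φ : StateFormula n AP) (typeU : TypeU γ)
                   (hyp : ∀ s → s ⊩ ind γ φ → s ⊩ φ) where

    top : Coalition n
    top = ⋃ (support γ)

    Bad : S → Set
    Bad s = ∃ λ σ → Achieves σ s γ × ¬ s ⊩ φ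

    abstract
      -- A fulfilled until-goal would make a disjunct of `ind γ φ` true, and then `φ` by hypothesis.
      pending : ∀ {s} → Bad s → Pending γ s
      pending (σ , ach , ¬φ) C α β eq q =
        ¬φ (hyp _ (⋁⁺ (Finish γ) (inj₁ (achieves-finish ach eq q))))

      -- Otherwise σ would itself achieve Δ γ ⟪ φ ⟫, and φ would hold at s by hyp.
      escape : ∀ {s} (b : Bad s) → ∃ λ σ′ → AgreeOn top (proj₁ b) σ′ × ¬ path σ′ s 1 ⊩ φ
      escape {s} b@(σ , ach , ¬φ) = stable λ none → ¬φ (hyp s (⋁⁺ (Finish γ) (inj₂
        (⋀⁺ (UHolds γ ++ GHolds γ) (achieves-holds ach (pending b)) (⟨⟩⁺ (Δ γ ⟪ φ ⟫) σ λ C →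
          ▷-elim (Enforces σ s) (Δ γ) top (X φ) C
            (λ σ′ agr → stable λ ¬p → none (σ′ , agr , ¬p))
            (λ _ → achieves-Δ ach (pending b) C))))))

    firstᵇ : ∀ {s} → Bad s → StrategyProfile
    firstᵇ b = proj₁ (escape b)

    abstract
      -- All support coalitions lie in `top` and have long-term goals, so on the support the
      -- residual for `top` is `γ` itself; the escaping profile agrees with `σ` on `top`.
      shift-achieves : ∀ {s} (b : Bad s) →
        Achieves (shift s (opening (firstᵇ b) s) (firstᵇ b)) (𝔤.out s (opening (firstᵇ b) s)) γ
      shift-achieves {s} b@(σ , ach , _) C = case trivial-or-support γ C of λ
        { (inj₁ eq) → subst (Enforces σ⁺ s⁺ C) (sym eq) (λ _ _ → tt)
        ; (inj₂ C∈) → subst (Enforces σ⁺ s⁺ C)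
            (residual-LongTerm γ (⊆-⋃ (∈-support⁺ {γ = γ} C∈)) (proj₁ typeU C C∈))
            (achieves-residual ach (pending b) (proj₁ (proj₂ (escape b))) C) }
        where
        σ⁺ : StrategyProfile
        σ⁺ = shift s (opening (firstᵇ b) s) (firstᵇ b)

        s⁺ : S
        s⁺ = 𝔤.out s (opening (firstᵇ b) s)

    advance : ∀ {s} (b : Bad s) → Bad (𝔤.out s (opening (firstᵇ b) s))
    advance b = _ , shift-achieves b , proj₂ (proj₂ (escape b))

    -- Only the intended play is steered to the next bad state. After any other step the current
    -- profile goes on, which keeps the agreement on `top`.
    nextᵇ : ∀ {s} → Bad s → (ζ : 𝔤.ActionProfile s) → Bad (𝔤.out s ζ) ⊎ StrategyProfile
    nextᵇ {s} b ζ with em {ζ ≡ opening (firstᵇ b) s}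
    ... | yes refl = inj₁ (advance b)
    ... | no _     = inj₂ (shift s ζ (firstᵇ b))

    nextᵇ-agree : ∀ {s} (b : Bad s) ζ →
                  AgreeOn top (shift s ζ (firstᵇ b)) ([ firstᵇ , id ]′ (nextᵇ b ζ))
    nextᵇ-agree {s} b ζ with em {ζ ≡ opening (firstᵇ b) s}
    ... | yes refl = proj₁ (proj₂ (escape (advance b)))
    ... | no _     = AgreeOn-refl top (shift s ζ (firstᵇ b))

    nextᵇ-opening : ∀ {s} (b : Bad s) → nextᵇ b (opening (firstᵇ b) s) ≡ inj₁ (advance b)
    nextᵇ-opening {s} b with em {opening (firstᵇ b) s ≡ opening (firstᵇ b) s}
    ... | yes refl = refl
    ... | no ¬p    = contradiction refl ¬p

    controller : Controller
    controller = record { Mode = Bad ; first = firstᵇ ; next = nextᵇ }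

    agree : ∀ {s} (b : Bad s) → AgreeOn top (proj₁ b) (unroll controller b)
    agree b = AgreeOn-trans {ρ = proj₁ b} {firstᵇ b} {unroll controller b}
      (proj₁ (proj₂ (escape b))) (unroll-agree controller nextᵇ-agree b)

    remains-bad : ∀ {s} (b : Bad s) i → Bad (path (unroll controller b) s i)
    remains-bad b zero = b
    remains-bad {s} b (suc i) = subst Bad
      (sym (trans (path-unroll controller b i)
                  (cong (λ r → path ([ unroll controller , id ]′ r) (𝔤.out s (opening (firstᵇ b) s)) i)
                        (nextᵇ-opening b))))
      (remains-bad (advance b) i)

    ¬bad : ∀ {s} → ¬ Bad s
    ¬bad {s} b@(σ , ach , _) with proj₂ typeU
    ... | C , α , β , eq
      with i , q , _ ← subst (path (unroll controller b) s ⊩ᵖ_) eq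
             (ach C (unroll controller b) (AgreeOn-⊆ {σ = σ} {unroll controller b}
               (⊆-⋃ (∈-support⁺ {γ = γ} (LongTerm⇒support γ C (inj₁ (α , β , eq))))) (agree b)))
      -- The bad state at index `i` comes with a profile of its own, but `Pending` concerns the
      -- state alone, so no until-goal of `γ` is fulfilled there.
      = pending (remains-bad b i) C α β eq q

    sound : ∀ {s} → s ⊩ ⟨[ γ ]⟩ → s ⊩ φ
    sound p = stable λ ¬φ → let σ , ach = ⟨⟩⁻ γ p in ¬bad (σ , ach , ¬φ)

  -- Merging profiles of disjoint coalitions.

  Goal : Set
  Goal = Coalition n × PathFormula n AP

  ⋀₁⁻ : ∀ {s} (f : Goal → StateFormula n AP) g gs →
        s ⊩ foldr₁ _`∧_ (List⁺.map f (g ∷ gs)) → All (λ g → s ⊩ f g) (g ∷ gs)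
  ⋀₁⁻ f g []        p       = p ∷ []
  ⋀₁⁻ f g (g′ ∷ gs) (p , q) = p ∷ ⋀₁⁻ f g′ gs q

  override : Coalition n → StrategyProfile → StrategyProfile → StrategyProfile
  override C σ τ a h with a ∈? C
  ... | yes _ = σ a h
  ... | no _  = τ a h

  override-agree : ∀ C σ τ → AgreeOn C σ (override C σ τ)
  override-agree C σ τ a a∈C h with a ∈? C
  ... | yes _  = refl
  ... | no a∉C = contradiction a∈C a∉C

  override-disjoint : ∀ {C D} σ τ → Empty (C ∩ D) → AgreeOn D τ (override C σ τ)
  override-disjoint {C} σ τ empty a a∈D h with a ∈? C
  ... | yes a∈C = contradiction (a , x∈p∩q⁺ (a∈C , a∈D)) empty
  ... | no _    = refl

  Enforces-agree : ∀ {C} σ τ s θ → AgreeOn C σ τ → Enforces σ s C θ → Enforces τ s C θ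
  Enforces-agree σ τ s θ agr enf σ′ agr′ = enf σ′ (AgreeOn-trans {ρ = σ} {τ} {σ′} agr agr′)

  -- Each witness is laid over the combination of the later ones; disjointness keeps the later
  -- coalitions on their own strategies.
  merge : ∀ {s} (gs : List Goal) → AllPairs DisjointDistinct gs →
          All (λ (C , θ) → s ⊩ ⟨[ γ⊤ [ C ▷ θ ] ]⟩) gs →
          ∃ λ σ → Achieves σ s (foldr (λ (C , θ) γ → γ [ C ▷ θ ]) γ⊤ gs)
  merge {s} gs disjoint ps = let σ , enf = combine gs disjoint ps in σ , assemble gs enf
    where
    combine : (gs : List Goal) → AllPairs DisjointDistinct gs →
              All (λ (C , θ) → s ⊩ ⟨[ γ⊤ [ C ▷ θ ] ]⟩) gs →
              ∃ λ σ → All (λ (C , θ) → Enforces σ s C θ) gs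
    combine []             []       []       = defaultProfile , []
    combine ((C , θ) ∷ gs) (d ∷ ds) (p ∷ ps) =
      let σ , ach = ⟨⟩⁻ (γ⊤ [ C ▷ θ ]) p
          τ , enf = combine gs ds ps
          ρ       = override C σ τ
      in ρ ,
         Enforces-agree σ ρ s θ (override-agree C σ τ)
           (subst (Enforces σ s C) (▷-same γ⊤ C θ) (ach C)) ∷
         All.zipWith (λ {(_ , θ′)} ((_ , empty) , enf) →
           Enforces-agree τ ρ s θ′ (override-disjoint σ τ empty) enf)
           (d , enf)

    assemble : ∀ {σ} (gs : List Goal) → All (λ (C , θ) → Enforces σ s C θ) gs →
               Achieves σ s (foldr (λ (C , θ) γ → γ [ C ▷ θ ]) γ⊤ gs)
    assemble []             []           D = λ _ _ → tt
    assemble {σ} ((C , θ) ∷ gs) (enf ∷ enfs) D =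
      ▷-elim (Enforces σ s) (foldr (λ (C , θ) γ → γ [ C ▷ θ ]) γ⊤ gs) C θ D enf
        (λ _ → assemble gs enfs D)

  -- Induction on derivations.

  soundness : ∀ {φ} → ⊢ φ → ∀ s → s ⊩ φ
  soundness (Taut {φ} taut) s = eval-true φ (taut truth)
  soundness Triv s = ⟨⟩⁺ γ⊤ defaultProfile λ _ _ _ → tt
  soundness Safe s p = let σ , ach = ⟨⟩⁻ (γ⊤ [ ⊤ ▷ X `⊥ ]) p in
    subst (path σ s ⊩ᵖ_) (▷-same γ⊤ ⊤ (X `⊥)) (ach ⊤ σ (AgreeOn-refl ⊤ σ)) tt
  soundness (Merge (g ∷ gs) disjoint) s = ⇒⁺ λ p →
    let σ , ach = merge (g ∷ gs) disjoint (⋀₁⁻ _ g gs p) in ⟨⟩⁺ _ σ ach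
  soundness (GrandCoalition γ φ ψ eq) s = ⇒⁺ λ p →
    let σ , ach = ⟨⟩⁻ γ p
        -- Agreement on all agents leaves one possible successor, and `ψ` either holds or fails
        -- there.
        only : ∀ σ′ → AgreeOn ⊤ σ σ′ → path σ′ s 1 ≡ path σ s 1
        only σ′ agr = cong proj₁ (play-cong {σ′} {σ} (λ a h → agr a ∈⊤ h) s 1)
        strengthen : ∀ χ → path σ s 1 ⊩ χ → s ⊩ ⟨[ γ [ ⊤ ▷ X (φ `∧ χ) ] ]⟩
        strengthen χ q = ⟨⟩⁺ (γ [ ⊤ ▷ X (φ `∧ χ) ]) σ λ D →
          ▷-elim (Enforces σ s) γ ⊤ (X (φ `∧ χ)) D
            (λ σ′ agr → subst (path σ′ s ⊩ᵖ_) eq (ach ⊤ σ′ agr) ,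
                        subst (_⊩ χ) (sym (only σ′ agr)) q)
            (λ _ → ach D)
    in case em {path σ s 1 ⊩ ψ} of λ
         { (yes q) → inj₁ (strengthen ψ q)
         ; (no ¬q) → inj₂ (strengthen (`¬ ψ) ¬q) }
  soundness (Case γ C φ ψ eq) s = ⇒⁺ λ p →
    let σ , ach = ⟨⟩⁻ γ p in
    -- A profile that agrees on `C` but leads to a state without `ψ` can be fixed for all agents
    -- while goals of coalitions inside `C` stay enforced; if there is none, `C` enforces `ψ` next.
    case em {∃ λ σ′ → AgreeOn C σ σ′ × ¬ path σ′ s 1 ⊩ ψ} of λ
      { (yes (σ′ , agr , ¬q)) → inj₂ (⟨⟩⁺ ((γ ∣ C) [ ⊤ ▷ X (`¬ ψ) ]) σ′ λ D →
          ▷-elim (Enforces σ′ s) (γ ∣ C) ⊤ (X (`¬ ψ)) D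
            (λ τ agrτ → subst (λ w → ¬ w ⊩ ψ)
              (sym (cong proj₁ (play-cong {τ} {σ′} (λ a h → agrτ a ∈⊤ h) s 1))) ¬q)
            (λ _ → ∣-elim (Enforces σ′ s D) γ C D (λ _ _ → tt) λ D⊆C →
              Enforces-agree σ σ′ s (γ D) (AgreeOn-⊆ {σ = σ} {σ′} D⊆C agr) (ach D)))
      ; (no none) → inj₁ (⟨⟩⁺ (γ [ C ▷ X (φ `∧ ψ) ]) σ λ D →
          ▷-elim (Enforces σ s) γ C (X (φ `∧ ψ)) D
            (λ σ′ agr → subst (path σ′ s ⊩ᵖ_) eq (ach C σ′ agr) ,
                        stable λ ¬q → none (σ′ , agr , ¬q))
            (λ _ → ach D)) }
  soundness (Con γ C C′ φ ψ eq eq′ C′⊆C) s = ⇒⁺ λ p →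
    let σ , ach = ⟨⟩⁻ γ p in
    ⟨⟩⁺ (γ [ C ▷ X (φ `∧ ψ) ]) σ λ D → ▷-elim (Enforces σ s) γ C (X (φ `∧ ψ)) D
      (λ σ′ agr → subst (path σ′ s ⊩ᵖ_) eq (ach C σ′ agr) ,
                  subst (path σ′ s ⊩ᵖ_) eq′ (ach C′ σ′ (AgreeOn-⊆ {σ = σ} {σ′} C′⊆C agr)))
      (λ _ → ach D)
  soundness (Fix γ) s = ⇒⁺ (Fix⁻ γ) , ⇒⁺ (Fix⁺ γ)
  soundness (MP d e) s = ⇒⁻ (soundness d s) (soundness e s)
  soundness (G-Mon γ C {φ} {ψ} d) s = ⇒⁺ λ p →
    let σ , ach = ⟨⟩⁻ (γ [ C ▷ X φ ]) p in
    ⟨⟩⁺ (γ [ C ▷ X ψ ]) σ λ D → ▷-elim (Enforces σ s) γ C (X ψ) D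
      (λ σ′ agr → ⇒⁻ (soundness d (path σ′ s 1))
        (subst (path σ′ s ⊩ᵖ_) (▷-same γ C (X φ)) (ach C σ′ agr)))
      (λ D≢C → subst (Enforces σ s D) (▷-other γ (X φ) D≢C) (ach D))
  soundness (R-Ind γ {φ} typeU d) s =
    ⇒⁺ (Induction.sound γ φ typeU (λ s → ⇒⁻ (soundness d s)))
  soundness (R-CoInd γ {φ} typeG d) s = ⇒⁺ λ p →
    ⟨⟩⁺ γ _ (CoInduction.achieves γ φ typeG (λ s → ⇒⁻ (soundness d s)) p)

proposition9 : ExcludedMiddle 0ℓ →
    ∀ {n : ℕ} {AP : Set} {φ : StateFormula n AP} → ⊢ φ → Valid φ
proposition9 em d M s = soundness em M d s
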